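{- Let $L=L(m,n;k,l)$ be an $L$-shaped supergrid graph. Then $L$ contains a Hamiltonian cycle if and only if $L$ has no vertex of degree $1$.
   Context: The infinite supergrid graph has as vertices all points $(x,y)\in\mathbb{Z}^2$, two distinct vertices $u=(u_x,u_y)$, $v=(v_x,v_y)$ being adjacent iff $|u_x-v_x|\le 1$ and $|u_y-v_y|\le 1$. A supergrid graph is a finite vertex-induced subgraph of it. For integers $m,n>1$ and $k,l\ge 1$ with $m-k\ge 1$ and $n-l\ge 1$, the $L$-shaped supergrid graph $L(m,n;k,l)$ is the supergrid graph induced by the vertex set $\{(x,y):1\le x\le m,\ 1\le y\le n\}\setminus\{(x,y): m-k+1\le x\le m,\ 1\le y\le l\}$ (i.e. the rectangle $R(m,n)$ with an $k\times l$ block removed from its upper-right corner, where $(1,1)$ is the upper-left corner and $y$ increases downward). A cycle is a closed simple path on at least $3$ distinct vertices. -}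

module Defs where

open import Data.Integer as ℤ using (ℤ; +_; ∣_∣)
import Data.Integer.Properties as ℤₚ
open import Data.List using (List; _∷_; _∷ʳ_; length; filter; applyUpTo; cartesianProduct)
open import Data.List.Membership.Propositional using (_∈_)
open import Data.List.Membership.Propositional.Properties
  using (∈-filter⁺; ∈-filter⁻; ∈-applyUpTo⁺; ∈-applyUpTo⁻; ∈-cartesianProduct⁺; ∈-cartesianProduct⁻)
open import Data.List.Relation.Unary.Linked using (Linked)
open import Data.List.Relation.Unary.Unique.Propositional using (Unique)
import Data.List.Relation.Unary.Unique.Propositional.Properties as Unique
open import Data.Nat using (ℕ; suc; _≤_; _≥_; z≤n; s≤s; _≤?_)
import Data.Nat.Properties as ℕₚ
open import Data.Product using (_×_; _,_; proj₁; proj₂; Σ-syntax)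
open import Data.Product.Properties using (≡-dec)
open import Function.Bundles using (_⇔_; mk⇔)
open import Relation.Binary.Definitions using (Decidable; DecidableEquality)
open import Relation.Binary.PropositionalEquality using (_≡_; _≢_; refl)
open import Relation.Nullary using (¬_; Dec; ¬?; _×-dec_)

Point : Set
Point = ℤ × ℤ

_≟ₚ_ : DecidableEquality Point
_≟ₚ_ = ≡-dec ℤ._≟_ ℤ._≟_

Adjacent∞ : Point → Point → Set
Adjacent∞ u v =
  u ≢ v
  × ∣ proj₁ u ℤ.- proj₁ v ∣ ≤ 1
  × ∣ proj₂ u ℤ.- proj₂ v ∣ ≤ 1

adjacent∞? : Decidable Adjacent∞
adjacent∞? u v =
  ¬? (u ≟ₚ v)
  ×-dec (∣ proj₁ u ℤ.- proj₁ v ∣ ≤? 1)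
  ×-dec (∣ proj₂ u ℤ.- proj₂ v ∣ ≤? 1)

-- The last three fields say that the vertex set is finite.
record SupergridGraph : Set₁ where
  field
    Vertex   : Point → Set
    vertices : List Point
    unique   : Unique vertices
    complete : ∀ v → v ∈ vertices ⇔ Vertex v

  Adjacent : Point → Point → Set
  Adjacent u v = Vertex u × Vertex v × Adjacent∞ u v

  -- Meaningful for v satisfying Vertex.
  degree : Point → ℕ
  degree v = length (filter (adjacent∞? v) vertices)

open SupergridGraph public using (Vertex; Adjacent; degree)

record Cycle (G : SupergridGraph) : Set where
  field
    start  : Point
    rest   : List Point

  points : List Point
  points = start ∷ rest

  field
    simple : Unique points
    closed : Linked (Adjacent G) (points ∷ʳ start)
    long   : length points ≥ 3

IsHamiltonian : ∀ {G} → Cycle G → Set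
IsHamiltonian {G} c = ∀ v → Vertex G v → v ∈ Cycle.points c

HasHamiltonianCycle : SupergridGraph → Set
HasHamiltonianCycle G = Σ[ c ∈ Cycle G ] IsHamiltonian c

InRectangle : ℕ → ℕ → Point → Set
InRectangle m n (x , y) =
  ((+ 1 ℤ.≤ x) × (x ℤ.≤ + m)) × ((+ 1 ℤ.≤ y) × (y ℤ.≤ + n))

InRemovedBlock : (m k l : ℕ) → Point → Set
InRemovedBlock m k l (x , y) =
  ((+ m ℤ.- + k ℤ.+ + 1 ℤ.≤ x) × (x ℤ.≤ + m)) × ((+ 1 ℤ.≤ y) × (y ℤ.≤ + l))

InL : (m n k l : ℕ) → Point → Set
InL m n k l v = InRectangle m n v × ¬ InRemovedBlock m k l v

inRemovedBlock? : ∀ m k l v → Dec (InRemovedBlock m k l v)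
inRemovedBlock? m k l (x , y) =
  ((+ m ℤ.- + k ℤ.+ + 1 ℤ.≤? x) ×-dec (x ℤ.≤? + m))
  ×-dec ((+ 1 ℤ.≤? y) ×-dec (y ℤ.≤? + l))

notRemoved? : ∀ m k l v → Dec (¬ InRemovedBlock m k l v)
notRemoved? m k l v = ¬? (inRemovedBlock? m k l v)

range : ℕ → List ℤ
range = applyUpTo (λ i → + suc i)

range-unique : ∀ m → Unique (range m)
range-unique m = Unique.applyUpTo⁺₁ _ m
  λ i<j _ eq → ℕₚ.<⇒≢ i<j (ℕₚ.suc-injective (ℤₚ.+-injective eq))

∈-range⁻ : ∀ {m x} → x ∈ range m → (+ 1 ℤ.≤ x) × (x ℤ.≤ + m)
∈-range⁻ x∈ with _ , i<m , refl ← ∈-applyUpTo⁻ _ x∈ =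
  ℤ.+≤+ (s≤s z≤n) , ℤ.+≤+ i<m

∈-range⁺ : ∀ {m x} → (+ 1 ℤ.≤ x) × (x ℤ.≤ + m) → x ∈ range m
∈-range⁺ (ℤ.+≤+ (s≤s _) , ℤ.+≤+ i<m) = ∈-applyUpTo⁺ _ i<m

L : (m n k l : ℕ) → SupergridGraph
L m n k l = record
  { Vertex   = InL m n k l
  ; vertices = filter (notRemoved? m k l) rectangle
  ; unique   = Unique.filter⁺ (notRemoved? m k l)
                 (Unique.cartesianProduct⁺ (range-unique m) (range-unique n))
  ; complete = λ v → mk⇔ to from
  }
  where
  rectangle : List Point
  rectangle = cartesianProduct (range m) (range n)

  to : ∀ {v} → v ∈ filter (notRemoved? m k l) rectangle → InL m n k l v
  to v∈ with v∈R , v∉B ← ∈-filter⁻ (notRemoved? m k l) {xs = rectangle} v∈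
        with x∈ , y∈ ← ∈-cartesianProduct⁻ (range m) (range n) v∈R =
    (∈-range⁻ x∈ , ∈-range⁻ y∈) , v∉B

  from : ∀ {v} → InL m n k l v → v ∈ filter (notRemoved? m k l) rectangle
  from ((x≤ , y≤) , v∉B) =
    ∈-filter⁺ (notRemoved? m k l)
      (∈-cartesianProduct⁺ (∈-range⁺ x≤) (∈-range⁺ y≤)) v∉B

{-# OPTIONS --safe #-}
module Submission where

-- A vertex on a cycle has two distinct neighbours there, so its degree is at
-- least 2.  Conversely, put a = m ∸ k and b = n ∸ l.  If a = 1 and l ≥ 2, the
-- corner (1 , 1) has degree 1; if b = 1 and k ≥ 2, the corner (m , n) does.
-- Otherwise a Hamiltonian cycle goes up the first column and comes back down
-- as a snake through the rows of the remaining columns.  A plain snake changes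
-- sides with every row, but two rows can also be crossed at once by a zigzag
-- using diagonals.  Building the snake from the bottom up, one therefore
-- obtains snakes to the bottom left corner from both the top left and the top
-- right corner as soon as there are two rows, and one more row preserves this.

open import Defs
open import Data.Empty using (⊥)
open import Data.Integer as ℤ using (+_; _⊖_)
import Data.Integer.Properties as ℤₚ
open import Data.List using (List; []; _∷_; _∷ʳ_; _++_; [_]; length; map; filter; replicate)
open import Data.List.Properties using (length-map; length-++; length-replicate; map-++; map-replicate)
open import Data.List.Membership.Propositional using (_∈_; _∉_)
open import Data.List.Membership.Propositional.Properties using (∈-++⁺ˡ; ∈-++⁺ʳ; ∈-++⁻; ∈-map⁺; ∈-map⁻; ∈-filter⁺; ∈-filter⁻)
open import Data.List.Relation.Unary.All as All using ([]; _∷_)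
open import Data.List.Relation.Unary.AllPairs using ([]; _∷_)
open import Data.List.Relation.Unary.Any using (here; there)
open import Data.List.Relation.Unary.Linked using (Linked; [-]; _∷_)
open import Data.List.Relation.Unary.Unique.Propositional using (Unique)
import Data.List.Relation.Unary.Unique.Propositional.Properties as Unique
open import Data.Nat using (ℕ; zero; suc; _+_; _∸_; _≤_; _<_; _>_; _≥_; z≤n; s≤s; s≤s⁻¹; ∣_-_∣; _<?_)
open import Data.Nat.Properties as ℕₚ using ()
open import Data.Product using (_×_; _,_; proj₁; proj₂; ∃-syntax)
open import Data.Sum using (_⊎_; inj₁; inj₂; swap; fromInj₁)
open import Function using (_∘_)
open import Function.Bundles using (_⇔_; mk⇔; Equivalence)
open import Relation.Binary.PropositionalEquality using (_≡_; _≢_; refl; sym; trans; cong; cong₂; subst)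
open import Relation.Nullary using (¬_; yes; no; contradiction)

-- Hamiltonian paths of regions of ℕ × ℕ

Cell : Set
Cell = ℕ × ℕ

Region : Set₁
Region = Cell → Set

-- Distance at most 1 in inductive form: adjacency at a joint of two paths is given by constructors
-- and analysed by matching.
data Near : ℕ → ℕ → Set where
  same : ∀ {x} → Near x x
  up   : ∀ {x} → Near x (suc x)
  down : ∀ {x} → Near (suc x) x

near-suc : ∀ {x y} → Near x y → Near (suc x) (suc y)
near-suc same = same
near-suc up   = up
near-suc down = down

Adj : Cell → Cell → Set
Adj p q = p ≢ q × Near (proj₁ p) (proj₁ q) × Near (proj₂ p) (proj₂ q)

data Path : Cell → Cell → Set where
  stop : ∀ p → Path p p
  step : ∀ p {q t} → Adj p q → Path q t → Path p t

cells : ∀ {s t} → Path s t → List Cell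
cells (stop p)     = [ p ]
cells (step p _ π) = p ∷ cells π

append : ∀ {s t u v} → Path s t → Adj t u → Path u v → Path s v
append (stop p)     a ρ = step p a ρ
append (step p b π) a ρ = step p b (append π a ρ)

cells-append : ∀ {s t u v} (π : Path s t) (a : Adj t u) (ρ : Path u v) →
               cells (append π a ρ) ≡ cells π ++ cells ρ
cells-append (stop p)     a ρ = refl
cells-append (step p b π) a ρ = cong (p ∷_) (cells-append π a ρ)

module _ (f : Cell → Cell) (f-adj : ∀ {p q} → Adj p q → Adj (f p) (f q)) where

  mapPath : ∀ {s t} → Path s t → Path (f s) (f t)
  mapPath (stop p)     = stop (f p)
  mapPath (step p a π) = step (f p) (f-adj a) (mapPath π)

  cells-mapPath : ∀ {s t} (π : Path s t) → cells (mapPath π) ≡ map f (cells π)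
  cells-mapPath (stop p)     = refl
  cells-mapPath (step p a π) = cong (f p ∷_) (cells-mapPath π)

record HamPath (P : Region) (s t : Cell) : Set where
  constructor hamPath
  field
    path     : Path s t
    simple   : Unique (cells path)
    sound    : ∀ {p} → p ∈ cells path → P p
    complete : ∀ p → P p → p ∈ cells path

-- `R` comes with evidence that it is the disjoint union of `P` and `Q`, so that a glued path can
-- again live in a region of the form `Rows ws`.
join : ∀ {P Q R : Region} {s t u v} →
       HamPath P s t → Adj t u → HamPath Q u v →
       (∀ p → P p → ¬ Q p) →
       (∀ p → P p → R p) → (∀ p → Q p → R p) → (∀ p → R p → P p ⊎ Q p) →
       HamPath R s v
join {P} {Q} {R} (hamPath π π-simple π⊆P P⊆π) a (hamPath ρ ρ-simple ρ⊆Q Q⊆ρ) disjoint P⊆R Q⊆R R⊆P∪Q =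
  hamPath (append π a ρ)
    (subst Unique (sym split)
      (Unique.++⁺ π-simple ρ-simple (λ (p∈π , p∈ρ) → disjoint _ (π⊆P p∈π) (ρ⊆Q p∈ρ))))
    (λ p∈ → sound (∈-++⁻ (cells π) (subst (_ ∈_) split p∈)))
    (λ p p∈R → subst (p ∈_) (sym split) (complete (R⊆P∪Q p p∈R)))
  where
  split : cells (append π a ρ) ≡ cells π ++ cells ρ
  split = cells-append π a ρ

  sound : ∀ {p} → p ∈ cells π ⊎ p ∈ cells ρ → R p
  sound (inj₁ p∈π) = P⊆R _ (π⊆P p∈π)
  sound (inj₂ p∈ρ) = Q⊆R _ (ρ⊆Q p∈ρ)

  complete : ∀ {p} → P p ⊎ Q p → p ∈ cells π ++ cells ρ
  complete (inj₁ p∈P) = ∈-++⁺ˡ (P⊆π _ p∈P)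
  complete (inj₂ p∈Q) = ∈-++⁺ʳ (cells π) (Q⊆ρ _ p∈Q)

module _ (f : Cell → Cell) (f-adj : ∀ {p q} → Adj p q → Adj (f p) (f q))
         (f-injective : ∀ {p q} → f p ≡ f q → p ≡ q) where

  image : ∀ {P Q : Region} {s t} → HamPath P s t →
          (∀ p → P p → Q (f p)) → (∀ q → Q q → ∃[ p ] P p × q ≡ f p) →
          HamPath Q (f s) (f t)
  image {P} {Q} (hamPath π π-simple π⊆P P⊆π) P⊆Q Q⊆fP = hamPath (mapPath f f-adj π)
    (subst Unique (sym mapped) (Unique.map⁺ f-injective π-simple))
    (λ p∈ → sound (∈-map⁻ f (subst (_ ∈_) mapped p∈)))
    (λ q q∈Q → subst (q ∈_) (sym mapped) (complete (Q⊆fP q q∈Q)))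
    where
    mapped : cells (mapPath f f-adj π) ≡ map f (cells π)
    mapped = cells-mapPath f f-adj π

    sound : ∀ {q} → ∃[ p ] p ∈ cells π × q ≡ f p → Q q
    sound (p , p∈π , refl) = P⊆Q p (π⊆P p∈π)

    complete : ∀ {q} → ∃[ p ] P p × q ≡ f p → q ∈ map f (cells π)
    complete (p , p∈P , refl) = ∈-map⁺ f (P⊆π p p∈P)

right : Cell → Cell
right (x , y) = suc x , y

below : Cell → Cell
below (x , y) = x , suc y

Right : Region → Region
Right P (zero  , y) = ⊥
Right P (suc x , y) = P (x , y)

Below : Region → Region
Below P (x , zero)  = ⊥
Below P (x , suc y) = P (x , y)

right-injective : ∀ {p q} → right p ≡ right q → p ≡ q
right-injective refl = refl

below-injective : ∀ {p q} → below p ≡ below q → p ≡ q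
below-injective refl = refl

right-adj : ∀ {p q} → Adj p q → Adj (right p) (right q)
right-adj (p≢q , x , y) = p≢q ∘ right-injective , near-suc x , y

below-adj : ∀ {p q} → Adj p q → Adj (below p) (below q)
below-adj (p≢q , x , y) = p≢q ∘ below-injective , x , near-suc y

shiftRight : ∀ {P s t} → HamPath P s t → HamPath (Right P) (right s) (right t)
shiftRight h = image right right-adj right-injective h
  (λ _ p∈P → p∈P) (λ { (suc x , y) p∈P → (x , y) , p∈P , refl })

shiftBelow : ∀ {P s t} → HamPath P s t → HamPath (Below P) (below s) (below t)
shiftBelow h = image below below-adj below-injective h
  (λ _ p∈P → p∈P) (λ { (x , suc y) p∈P → (x , y) , p∈P , refl })

-- Snakes through left-aligned rows

-- Widths are listed from top to bottom, as `y` grows downward. Width 0 arises when an arm of width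
-- 1 loses its first column.
Rows : List ℕ → Region
Rows []       _           = ⊥
Rows (w ∷ ws) (x , zero)  = x < w
Rows (w ∷ ws) (x , suc y) = Rows ws (x , y)

consRow : ∀ {w ws s t u v} → HamPath (Rows [ w ]) s t → Adj t (below u) →
          HamPath (Rows ws) u v → HamPath (Rows (w ∷ ws)) s (below v)
consRow h a g = join h a (shiftBelow g)
  (λ { (_ , zero) _ () ; (_ , suc _) () })
  (λ { (_ , zero) p∈ → p∈ ; (_ , suc _) () })
  (λ { (_ , zero) () ; (_ , suc _) p∈ → p∈ })
  (λ { (_ , zero) → inj₁ ; (_ , suc _) → inj₂ })

-- A zigzag alternates between its two rows, so in general two uses of `consRow` cannot produce it.
consTwoRows : ∀ {w w′ ws s t u v} → HamPath (Rows (w ∷ w′ ∷ [])) s t → Adj t (below (below u)) →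
              HamPath (Rows ws) u v → HamPath (Rows (w ∷ w′ ∷ ws)) s (below (below v))
consTwoRows h a g = join h a (shiftBelow (shiftBelow g))
  (λ { (_ , zero) _ () ; (_ , suc zero) _ () ; (_ , suc (suc _)) () })
  (λ { (_ , zero) p∈ → p∈ ; (_ , suc zero) p∈ → p∈ ; (_ , suc (suc _)) () })
  (λ { (_ , zero) () ; (_ , suc zero) () ; (_ , suc (suc _)) p∈ → p∈ })
  (λ { (_ , zero) → inj₁ ; (_ , suc zero) → inj₁ ; (_ , suc (suc _)) → inj₂ })

cell : HamPath (Rows [ 1 ]) (0 , 0) (0 , 0)
cell = hamPath (stop _) ([] ∷ []) (λ { (here refl) → s≤s z≤n })
  (λ { (zero , zero) _ → here refl ; (suc _ , zero) (s≤s ()) })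

row→ : ∀ w → HamPath (Rows [ suc w ]) (0 , 0) (w , 0)
row→ zero    = cell
row→ (suc w) = join cell ((λ ()) , up , same) (shiftRight (row→ w))
  (λ { (zero , _) _ () ; (suc _ , zero) (s≤s ()) })
  (λ { (_ , zero) (s≤s z≤n) → s≤s z≤n })
  (λ { (suc _ , zero) x<w → s≤s x<w })
  (λ { (zero , zero) _ → inj₁ (s≤s z≤n) ; (suc _ , zero) (s≤s x<w) → inj₂ x<w })

row← : ∀ w → HamPath (Rows [ suc w ]) (w , 0) (0 , 0)
row← zero    = cell
row← (suc w) = join (shiftRight (row← w)) ((λ ()) , down , same) cell
  (λ { (zero , _) () ; (suc _ , zero) _ (s≤s ()) })
  (λ { (suc _ , zero) x<w → s≤s x<w })
  (λ { (_ , zero) (s≤s z≤n) → s≤s z≤n })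
  (λ { (zero , zero) _ → inj₂ (s≤s z≤n) ; (suc _ , zero) (s≤s x<w) → inj₁ x<w })

column↓ : ∀ h → HamPath (Rows (replicate (suc h) 1)) (0 , 0) (0 , h)
column↓ zero    = cell
column↓ (suc h) = consRow cell ((λ ()) , same , up) (column↓ h)

column↑ : ∀ h → HamPath (Rows (replicate (suc h) 1)) (0 , h) (0 , 0)
column↑ zero    = cell
column↑ (suc h) = join (shiftBelow (column↑ h)) ((λ ()) , same , down) cell
  (λ { (_ , zero) () ; (_ , suc _) _ () })
  (λ { (_ , zero) () ; (_ , suc _) p∈ → p∈ })
  (λ { (_ , zero) p∈ → p∈ ; (_ , suc _) () })
  (λ { (_ , zero) → inj₂ ; (_ , suc _) → inj₁ })

firstColumn⊎rest : ∀ ws p → Rows (map suc ws) p → Rows (replicate (length ws) 1) p ⊎ Right (Rows ws) p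
firstColumn⊎rest (w ∷ ws) (zero  , zero)  _         = inj₁ (s≤s z≤n)
firstColumn⊎rest (w ∷ ws) (suc x , zero)  (s≤s x<w) = inj₂ x<w
-- `Right` is empty in column 0, which leaves only the left summand.
firstColumn⊎rest (w ∷ ws) (zero  , suc y) p∈ with firstColumn⊎rest ws (zero , y) p∈
... | inj₁ p∈column = inj₁ p∈column
firstColumn⊎rest (w ∷ ws) (suc x , suc y) p∈ = firstColumn⊎rest ws (suc x , y) p∈

firstColumn⊆ : ∀ ws p → Rows (replicate (length ws) 1) p → Rows (map suc ws) p
firstColumn⊆ (w ∷ ws) (_ , zero)  (s≤s z≤n) = s≤s z≤n
firstColumn⊆ (w ∷ ws) (x , suc y) p∈        = firstColumn⊆ ws (x , y) p∈

rest⊆ : ∀ ws p → Right (Rows ws) p → Rows (map suc ws) p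
rest⊆ (w ∷ ws) (suc x , zero)  x<w = s≤s x<w
rest⊆ (w ∷ ws) (suc x , suc y) p∈  = rest⊆ ws (suc x , y) p∈

firstColumn∩rest : ∀ ws p → Right (Rows ws) p → ¬ Rows (replicate (length ws) 1) p
firstColumn∩rest (w ∷ ws) (suc x , zero)  _  (s≤s ())
firstColumn∩rest (w ∷ ws) (suc x , suc y) p∈ p∈column = firstColumn∩rest ws (suc x , y) p∈ p∈column

consColumn : ∀ ws {s t u v} → HamPath (Rows (replicate (length ws) 1)) s t → Adj t (right u) →
             HamPath (Rows ws) u v → HamPath (Rows (map suc ws)) s (right v)
consColumn ws h a g = join h a (shiftRight g)
  (λ p p∈column p∈rest → firstColumn∩rest ws p p∈rest p∈column)
  (firstColumn⊆ ws) (rest⊆ ws) (firstColumn⊎rest ws)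

snocColumn : ∀ ws {s t u v} → HamPath (Rows ws) s t → Adj (right t) u →
             HamPath (Rows (replicate (length ws) 1)) u v → HamPath (Rows (map suc ws)) (right s) v
snocColumn ws g a h = join (shiftRight g) a h
  (firstColumn∩rest ws) (rest⊆ ws) (firstColumn⊆ ws) (λ p → swap ∘ firstColumn⊎rest ws p)

-- Each column of two cells is walked downward, followed by a diagonal step up to the next. Past the
-- end of the upper row the lower one is walked straight, so it may be longer by any amount.
zigzag→ : ∀ {w v} → w ≤ v → HamPath (Rows (suc w ∷ suc v ∷ [])) (0 , 0) (v , 1)
zigzag→ {v = v} z≤n       = consRow cell ((λ ()) , same , up) (row→ v)
zigzag→         (s≤s w≤v) = consColumn (_ ∷ _ ∷ []) (column↓ 1) ((λ ()) , up , down) (zigzag→ w≤v)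

-- The overhang of the lower row is visited first, and the first step from the upper right corner
-- gets at most one column further; hence the bound `v ≤ suc w`.
zigzag← : ∀ {w v} → w ≤ v → v ≤ suc w → HamPath (Rows (suc w ∷ suc v ∷ [])) (w , 0) (0 , 1)
zigzag← z≤n       z≤n         = consRow cell ((λ ()) , same , up) (row← 0)
-- An overhang of one cell: diagonally down to `(1 , 1)`, then back to `(0 , 1)`.
zigzag← z≤n       (s≤s z≤n)   = consRow cell ((λ ()) , up , up) (row← 1)
zigzag← (s≤s w≤v) (s≤s v≤1+w) = snocColumn (_ ∷ _ ∷ []) (zigzag← w≤v v≤1+w) ((λ ()) , down , down) (column↓ 1)

mutual

  -- A row switches sides, so the recursions alternate. A single row walked from the left ends on
  -- the right, hence at least two rows here; from the right, two rows have the wrong parity and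
  -- take the zigzag.
  rectangleFromLeft : ∀ w h → HamPath (Rows (replicate (suc (suc h)) (suc w))) (0 , 0) (0 , suc h)
  rectangleFromLeft w h = consRow (row→ w) ((λ ()) , same , up) (rectangleFromRight w h)

  rectangleFromRight : ∀ w h → HamPath (Rows (replicate (suc h) (suc w))) (w , 0) (0 , h)
  rectangleFromRight w zero          = row← w
  rectangleFromRight w (suc zero)    = zigzag← ℕₚ.≤-refl (ℕₚ.n≤1+n w)
  rectangleFromRight w (suc (suc h)) = consRow (row← w) ((λ ()) , same , up) (rectangleFromLeft w h)

-- Adding a row on top builds each snake from the opposite one, so the induction carries both.
record Snakes (w : ℕ) (ws : List ℕ) (h : ℕ) : Set where
  field
    fromLeft  : HamPath (Rows (suc w ∷ ws)) (0 , 0) (0 , h)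
    fromRight : HamPath (Rows (suc w ∷ ws)) (w , 0) (0 , h)

open Snakes

addRows : ∀ {w ws h} l → Snakes w ws h → Snakes w (replicate l (suc w) ++ ws) (l + h)
addRows zero    s = s
addRows {w} (suc l) s = record
  { fromLeft  = consRow (row→ w) ((λ ()) , same , up) (fromRight (addRows l s))
  ; fromRight = consRow (row← w) ((λ ()) , same , up) (fromLeft (addRows l s))
  }

-- Two wide rows suffice: `rectangleFromLeft` takes two, while the zigzag uses up one and leaves at
-- least one for `rectangleFromRight`.
overRectangle : ∀ {w v} h → w ≤ v → Snakes w (replicate (suc (suc h)) (suc v)) (suc (suc h))
overRectangle {w} {v} h w≤v = record
  { fromLeft  = consTwoRows (zigzag→ w≤v) ((λ ()) , same , up) (rectangleFromRight v h)
  ; fromRight = consRow (row← w) ((λ ()) , same , up) (rectangleFromLeft v h)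
  }

-- Over a single wide row, an overhang of one cell is within reach of a diagonal step from the right
-- end of the narrow row.
overRow : ∀ w → Snakes w [ suc (suc w) ] 1
overRow w = record
  { fromLeft  = consRow (row→ w) ((λ ()) , up , up) (row← (suc w))
  ; fromRight = zigzag← (ℕₚ.n≤1+n w) ℕₚ.≤-refl
  }

emptyRow : ∀ {ws s t} → HamPath (Rows ws) s t → HamPath (Rows (0 ∷ ws)) (below s) (below t)
emptyRow h = image below below-adj below-injective h
  (λ _ p∈P → p∈P) (λ { (x , suc y) p∈P → (x , y) , p∈P , refl })

-- Closing snakes to Hamiltonian cycles

record HamCycle (P : Region) : Set where
  constructor hamCycle
  field
    {first last} : Cell
    hamiltonian  : HamPath P first last
    closing      : Adj last first
    long         : 3 ≤ length (cells (HamPath.path hamiltonian))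

three-cells : ∀ {P s t u} (h : HamPath P s t) → P u → s ≢ t → u ≢ s → u ≢ t →
              3 ≤ length (cells (HamPath.path h))
three-cells (hamPath (stop _) _ _ _) _ s≢t _ _ = contradiction refl s≢t
three-cells (hamPath (step _ _ (stop _)) _ _ complete) u∈P _ u≢s u≢t with complete _ u∈P
... | here u≡s         = contradiction u≡s u≢s
... | there (here u≡t) = contradiction u≡t u≢t
three-cells (hamPath (step _ _ (step _ _ (stop _)))     _ _ _) _ _ _ _ = s≤s (s≤s (s≤s z≤n))
three-cells (hamPath (step _ _ (step _ _ (step _ _ _))) _ _ _) _ _ _ _ = s≤s (s≤s (s≤s z≤n))

-- The cycle is the snake moved one column right, a step left from its end, the first column upward,
-- and a step from `(0 , 0)` to the start of the snake. That start may lie in row 0, or in row 1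
-- below an empty first row.
addReturnColumn : ∀ ws {y h} → length ws ≡ suc h → 1 ≤ h → Near 0 y →
                  HamPath (Rows ws) (0 , y) (0 , h) → HamCycle (Rows (map suc ws))
addReturnColumn (_ ∷ [])       refl ()
addReturnColumn ws@(_ ∷ _ ∷ _) {h = h} refl _ near snake = hamCycle cycle ((λ ()) , up , near)
  (three-cells {u = 0 , 1} cycle (s≤s z≤n) (λ ()) (λ ()) (λ ()))
  where
  cycle : HamPath (Rows (map suc ws)) _ (0 , 0)
  cycle = snocColumn ws snake ((λ ()) , down , same) (column↑ h)

lShape : (l b a c : ℕ) → List ℕ
lShape l b a c = replicate l a ++ replicate b c

length-lShape : ∀ l b a c → length (lShape l b a c) ≡ l + b
length-lShape l b a c = trans (length-++ (replicate l a)) (cong₂ _+_ (length-replicate l) (length-replicate b))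

map-suc-lShape : ∀ l b a c → map suc (lShape l b a c) ≡ lShape l b (suc a) (suc c)
map-suc-lShape l b a c = trans (map-++ suc (replicate l a) (replicate b c))
  (cong₂ _++_ (map-replicate suc l a) (map-replicate suc b c))

-- The parameters are one less than the sizes. The last two premises say that an upper arm of width
-- 1 has height 1 and that a lower arm of height 1 overhangs by one column.
lShape-cycle : ∀ {a c} l b → a < c → (a ≡ 0 → l ≡ 0) → (b ≡ 0 → c ≡ suc a) →
               HamCycle (Rows (lShape (suc l) (suc b) (suc a) (suc c)))
lShape-cycle {a} {c} l b a<c narrow flat =
  subst (HamCycle ∘ Rows) (map-suc-lShape (suc l) (suc b) a c) (cycle l b a<c narrow flat)
  where
  positive : ∀ l {h} → 1 ≤ l + suc h
  positive l = ℕₚ.≤-trans (s≤s z≤n) (ℕₚ.m≤n+m _ l)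

  -- Without the return column the widths are `a` and `c`, so `a ≡ 0` means an empty top row.
  cycle : ∀ {a c} l b → a < c → (a ≡ 0 → l ≡ 0) → (b ≡ 0 → c ≡ suc a) →
          HamCycle (Rows (map suc (lShape (suc l) (suc b) a c)))
  cycle {zero} l b _ narrow flat with narrow refl
  cycle {zero} _ zero _ _ flat | refl with refl ← flat refl =
    addReturnColumn (0 ∷ 1 ∷ []) refl (s≤s z≤n) up (emptyRow (row← 0))
  cycle {zero} {suc c} _ (suc b) _ _ _ | refl =
    addReturnColumn (lShape 1 (2 + b) 0 (suc c)) (length-lShape 1 (2 + b) 0 (suc c)) (s≤s z≤n) up
      (emptyRow (rectangleFromLeft c b))
  -- From here on the lowest narrow row belongs to the base, and `addRows` supplies the other `l`.
  cycle {suc a} l zero _ _ flat with refl ← flat refl =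
    addReturnColumn (lShape (suc l) 1 (suc a) (2 + a)) (length-lShape (suc l) 1 (suc a) (2 + a)) (positive l) same
      (fromLeft (addRows l (overRow a)))
  cycle {suc a} {suc c} l (suc b) (s≤s a<c) _ _ =
    addReturnColumn (lShape (suc l) (2 + b) (suc a) (suc c)) (length-lShape (suc l) (2 + b) (suc a) (suc c)) (positive l) same
      (fromLeft (addRows l (overRectangle b (ℕₚ.<⇒≤ a<c))))

-- Embedding into the supergrid

embed : Cell → Point
embed (x , y) = + suc x , + suc y

embed-injective : ∀ {p q} → embed p ≡ embed q → p ≡ q
embed-injective refl = refl

∣⊖∣≡∣-∣ : ∀ x y → ℤ.∣ x ⊖ y ∣ ≡ ∣ x - y ∣
∣⊖∣≡∣-∣ zero    zero    = refl
∣⊖∣≡∣-∣ zero    (suc y) = refl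
∣⊖∣≡∣-∣ (suc x) zero    = refl
∣⊖∣≡∣-∣ (suc x) (suc y) = trans (cong ℤ.∣_∣ (ℤₚ.[1+m]⊖[1+n]≡m⊖n x y)) (∣⊖∣≡∣-∣ x y)

near⇒∣-∣≤1 : ∀ {x y} → Near x y → ∣ x - y ∣ ≤ 1
near⇒∣-∣≤1 {x}           same = ℕₚ.≤-trans (ℕₚ.≤-reflexive (ℕₚ.∣n-n∣≡0 x)) z≤n
near⇒∣-∣≤1 {zero}        up   = s≤s z≤n
near⇒∣-∣≤1 {suc x}       up   = near⇒∣-∣≤1 {x} up
near⇒∣-∣≤1 {suc zero}    down = s≤s z≤n
near⇒∣-∣≤1 {suc (suc x)} down = near⇒∣-∣≤1 {suc x} down

∣-∣≤1⇒near : ∀ x y → ∣ x - y ∣ ≤ 1 → Near x y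
∣-∣≤1⇒near zero       zero       _ = same
∣-∣≤1⇒near zero       (suc zero) _ = up
∣-∣≤1⇒near (suc zero) zero       _ = down
∣-∣≤1⇒near (suc x)    (suc y)    d = near-suc (∣-∣≤1⇒near x y d)
∣-∣≤1⇒near zero          (suc (suc _)) (s≤s ())
∣-∣≤1⇒near (suc (suc _)) zero          (s≤s ())

near⁺ : ∀ {x y} → Near x y → ℤ.∣ + suc x ℤ.- + suc y ∣ ≤ 1
near⁺ {x} {y} xy = subst (_≤ 1) (sym (∣⊖∣≡∣-∣ (suc x) (suc y))) (near⇒∣-∣≤1 xy)

near⁻ : ∀ {x y} → ℤ.∣ + suc x ℤ.- + suc y ∣ ≤ 1 → Near x y
near⁻ {x} {y} d = ∣-∣≤1⇒near x y (subst (_≤ 1) (∣⊖∣≡∣-∣ (suc x) (suc y)) d)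

adj⁺ : ∀ {p q} → Adj p q → Adjacent∞ (embed p) (embed q)
adj⁺ (p≢q , x , y) = p≢q ∘ embed-injective , near⁺ x , near⁺ y

adj⁻ : ∀ {p q} → Adjacent∞ (embed p) (embed q) → Adj p q
adj⁻ (p≢q , x , y) = p≢q ∘ cong embed , near⁻ x , near⁻ y

-- `y < l → x < a` is avoidance of the removed block, in coordinates counted from 0.
rows⁺ : ∀ {a c} l b {x y} → x < c → y < b + l → (y < l → x < a) → Rows (lShape l b a c) (x , y)
rows⁺ zero (suc b) {y = zero}  x<c _ _ = x<c
rows⁺ {a} zero (suc b) {y = suc y} x<c (s≤s y<b) _ = rows⁺ {a} zero b x<c y<b λ ()
rows⁺ (suc l) b {y = zero}  _ _ corner = corner (s≤s z≤n)
rows⁺ (suc l) b {y = suc y} x<c y<n corner =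
  rows⁺ l b x<c (s≤s⁻¹ (subst (suc y <_) (ℕₚ.+-suc b l) y<n)) (corner ∘ s≤s)

rows⁻ : ∀ {a c} l b {x y} → a ≤ c → Rows (lShape l b a c) (x , y) → x < c × y < b + l × (y < l → x < a)
rows⁻ zero (suc b) {y = zero} a≤c x<c = x<c , s≤s z≤n , λ ()
rows⁻ zero (suc b) {y = suc y} a≤c p∈ with x<c , y<n , _ ← rows⁻ zero b a≤c p∈ = x<c , s≤s y<n , λ ()
rows⁻ (suc l) b {y = zero} a≤c x<a = ℕₚ.≤-trans x<a a≤c , ℕₚ.≤-trans (s≤s z≤n) (ℕₚ.m≤n+m _ b) , λ _ → x<a
rows⁻ (suc l) b {y = suc y} a≤c p∈ with x<c , y<n , corner ← rows⁻ l b a≤c p∈ =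
  x<c , subst (suc y <_) (sym (ℕₚ.+-suc b l)) (s≤s y<n) , corner ∘ s≤s⁻¹

block-left : ∀ k a → + (k + a) ℤ.- + k ℤ.+ + 1 ≡ + suc a
block-left k a = trans (cong (ℤ._+ + 1) (trans (ℤₚ.m-n≡m⊖n (k + a) k)
    (trans (ℤₚ.⊖-≥ (ℕₚ.m≤m+n k a)) (cong +_ (ℕₚ.m+n∸m≡n k a)))))
  (cong +_ (ℕₚ.+-comm a 1))

vertex⁺ : ∀ k a b l {p} → Rows (lShape l b a (k + a)) p → InL (k + a) (b + l) k l (embed p)
vertex⁺ k a b l p∈ with x<m , y<n , corner ← rows⁻ l b (ℕₚ.m≤n+m a k) p∈ =
  ((ℤ.+≤+ (s≤s z≤n) , ℤ.+≤+ x<m) , (ℤ.+≤+ (s≤s z≤n) , ℤ.+≤+ y<n)) ,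
  λ ((a<x , _) , (_ , y≤l)) →
    ℕₚ.<⇒≱ (corner (ℤₚ.drop‿+≤+ y≤l)) (s≤s⁻¹ (ℤₚ.drop‿+≤+ (subst (ℤ._≤ _) (block-left k a) a<x)))

vertex⁻ : ∀ k a b l {v} → InL (k + a) (b + l) k l v → ∃[ p ] v ≡ embed p × Rows (lShape l b a (k + a)) p
vertex⁻ k a b l (((ℤ.+≤+ (s≤s {n = x} _) , ℤ.+≤+ x<m) , (ℤ.+≤+ (s≤s {n = y} _) , ℤ.+≤+ y<n)) , ∉block) =
  (x , y) , refl , rows⁺ l b x<m y<n corner
  where
  corner : y < l → x < a
  corner y<l with x <? a
  ... | yes x<a = x<a
  ... | no  x≮a = contradiction
    ((subst (ℤ._≤ _) (sym (block-left k a)) (ℤ.+≤+ (s≤s (ℕₚ.≮⇒≥ x≮a))) , ℤ.+≤+ x<m) ,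
     (ℤ.+≤+ (s≤s z≤n) , ℤ.+≤+ y<l)) ∉block

module _ {G : SupergridGraph} {P : Region}
         (P⊆G : ∀ {p} → P p → Vertex G (embed p))
         (G⊆P : ∀ {v} → Vertex G v → ∃[ p ] v ≡ embed p × P p) where

  embed-linked : ∀ {s t u} (π : Path s t) → (∀ {p} → p ∈ cells π → P p) → Adj t u → P u →
                 Linked (Adjacent G) (map embed (cells π) ∷ʳ embed u)
  embed-linked (stop _) π⊆P a u∈P = (P⊆G (π⊆P (here refl)) , P⊆G u∈P , adj⁺ a) ∷ [-]
  -- The tail is matched too, because `cells` shows its head only once the constructor of the path
  -- is known.
  embed-linked (step _ b (stop _)) π⊆P a u∈P =
    (P⊆G (π⊆P (here refl)) , P⊆G (π⊆P (there (here refl))) , adj⁺ b) ∷ embed-linked (stop _) (π⊆P ∘ there) a u∈P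
  embed-linked (step _ b π@(step _ _ _)) π⊆P a u∈P =
    (P⊆G (π⊆P (here refl)) , P⊆G (π⊆P (there (here refl))) , adj⁺ b) ∷ embed-linked π (π⊆P ∘ there) a u∈P

  embed-cycle : HamCycle P → HasHamiltonianCycle G
  embed-cycle (hamCycle (hamPath (stop _) _ _ _) _ (s≤s ()))
  embed-cycle (hamCycle (hamPath π@(step s _ ρ) simple sound complete) closing long) =
    record
      { start  = embed s
      ; rest   = map embed (cells ρ)
      ; simple = Unique.map⁺ embed-injective simple
      ; closed = embed-linked π sound closing (sound (here refl))
      ; long   = subst (3 ≤_) (sym (length-map embed (cells π))) long
      } ,
    covers
    where
    covers : ∀ v → Vertex G v → v ∈ map embed (cells π)
    covers v v∈G with p , refl , p∈P ← G⊆P v∈G = ∈-map⁺ embed (complete p p∈P)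

-- Vertices of degree one

Adjacent∞-sym : ∀ {u v} → Adjacent∞ u v → Adjacent∞ v u
Adjacent∞-sym {ux , uy} {vx , vy} (u≢v , dx , dy) =
  u≢v ∘ sym , subst (_≤ 1) (ℤₚ.∣i-j∣≡∣j-i∣ ux vx) dx , subst (_≤ 1) (ℤₚ.∣i-j∣≡∣j-i∣ uy vy) dy

length≡1⇒unique : ∀ {A : Set} {xs : List A} {x y} → length xs ≡ 1 → x ∈ xs → y ∈ xs → x ≡ y
length≡1⇒unique {xs = _ ∷ []} _ (here refl) (here refl) = refl

unique⇒length≡1 : ∀ {A : Set} {xs : List A} {u} → Unique xs → u ∈ xs → (∀ {x} → x ∈ xs → x ≡ u) → length xs ≡ 1
unique⇒length≡1 {xs = _ ∷ []}    _ _ _ = refl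
unique⇒length≡1 {xs = _ ∷ _ ∷ _} ((x≢y ∷ _) ∷ _) _ all≡u =
  contradiction (trans (all≡u (here refl)) (sym (all≡u (there (here refl))))) x≢y

module _ (G : SupergridGraph) where
  open SupergridGraph G using (vertices; unique; complete)

  neighbours : Point → List Point
  neighbours v = filter (adjacent∞? v) vertices

  ∈-neighbours : ∀ {u v} → Vertex G u → Adjacent∞ v u → u ∈ neighbours v
  ∈-neighbours {u} {v} u∈G a = ∈-filter⁺ (adjacent∞? v) (Equivalence.from (complete u) u∈G) a

  degree≡1 : ∀ {v u} → Vertex G u → Adjacent∞ v u →
             (∀ {w} → Vertex G w → Adjacent∞ v w → w ≡ u) → degree G v ≡ 1
  degree≡1 {v} u∈G a only = unique⇒length≡1 (Unique.filter⁺ (adjacent∞? v) unique) (∈-neighbours u∈G a) only′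
    where
    only′ : ∀ {w} → w ∈ neighbours v → w ≡ _
    only′ w∈ with w∈G , b ← ∈-filter⁻ (adjacent∞? v) {xs = vertices} w∈ =
      only (Equivalence.to (complete _) w∈G) b

  two-neighbours : ∀ {u v w} → Adjacent G u v → Adjacent G v w → u ≢ w → degree G v ≢ 1
  two-neighbours (u∈G , _ , uv) (_ , w∈G , vw) u≢w deg =
    u≢w (length≡1⇒unique deg (∈-neighbours u∈G (Adjacent∞-sym uv)) (∈-neighbours w∈G vw))

module _ {A : Set} {R : A → A → Set} where

  -- Provides the neighbour of the start of a cycle across the closing edge.
  linked-predecessor : ∀ {x xs z} → Linked R (x ∷ xs ∷ʳ z) → ∃[ y ] y ∈ x ∷ xs × R y z
  linked-predecessor {x} {[]} (r ∷ _) = x , here refl , r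
  linked-predecessor {xs = _ ∷ _} (_ ∷ rs) with y , y∈ , r ← linked-predecessor rs = y , there y∈ , r

  -- `z` will be the start of the cycle, repeated at the end. Uniqueness separates the two
  -- neighbours of an entry, except for the last one, whose successor is `z`: there `x ≢ z` does it,
  -- and `z ∉ xs` restores that premise in the recursion.
  linked-interior : ∀ {x xs z v} → Linked R (x ∷ xs ∷ʳ z) → Unique (x ∷ xs) → x ≢ z → z ∉ xs → v ∈ xs →
                    ∃[ u ] ∃[ w ] R u v × R v w × u ≢ w
  linked-interior {xs = _ ∷ []} (r ∷ r′ ∷ _) _ x≢z _ (here refl) = _ , _ , r , r′ , x≢z
  linked-interior {xs = _ ∷ _ ∷ _} (r ∷ r′ ∷ _) ((_ ∷ x≢y ∷ _) ∷ _) _ _ (here refl) = _ , _ , r , r′ , x≢y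
  linked-interior {xs = _ ∷ _} (_ ∷ rs) (_ ∷ distinct) _ z∉ (there v∈) =
    linked-interior rs distinct (λ { refl → z∉ (here refl) }) (z∉ ∘ there) v∈

  cycle-neighbours : ∀ {s xs v} → Linked R (s ∷ xs ∷ʳ s) → Unique (s ∷ xs) → 3 ≤ length (s ∷ xs) → v ∈ s ∷ xs →
                     ∃[ u ] ∃[ w ] R u v × R v w × u ≢ w
  cycle-neighbours {xs = []}     _ _ (s≤s ())
  cycle-neighbours {xs = _ ∷ []} _ _ (s≤s (s≤s ()))
  -- The last entry lies in `y ∷ ys` and so differs from `x`; this is where three entries matter.
  cycle-neighbours {xs = x ∷ y ∷ ys} (r ∷ r′ ∷ rs) (_ ∷ x≢ ∷ _) _ (here refl)
    with u , u∈ , r″ ← linked-predecessor {x = y} {xs = ys} rs =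
    u , x , r″ , r , λ { refl → All.lookup x≢ u∈ refl }
  cycle-neighbours {xs = x ∷ y ∷ ys} (r ∷ r′ ∷ rs) ((_ ∷ s≢y ∷ _) ∷ _) _ (there (here refl)) = _ , _ , r , r′ , s≢y
  cycle-neighbours {xs = x ∷ y ∷ ys} (r ∷ rs) ((s≢x ∷ s≢) ∷ distinct) _ (there (there v∈)) =
    linked-interior rs distinct (s≢x ∘ sym) (λ s∈ → All.lookup s≢ s∈ refl) v∈

HasLeaf : SupergridGraph → Set
HasLeaf G = ∃[ v ] Vertex G v × degree G v ≡ 1

cycle⇒¬leaf : ∀ G → HasHamiltonianCycle G → ¬ HasLeaf G
cycle⇒¬leaf G (c , ham) (v , v∈G , deg)
  with _ , _ , uv , vw , u≢w ← cycle-neighbours (Cycle.closed c) (Cycle.simple c) (Cycle.long c) (ham v v∈G) =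
  two-neighbours G uv vw u≢w deg

-- Rows 0 and 1 have width 1, so `(0 , 0)` has only the cell beneath it as a neighbour.
leaf-narrow : ∀ k b l → HasLeaf (L (k + 1) (b + (2 + l)) k (2 + l))
leaf-narrow k b l = embed (0 , 0) , vertex⁺ k 1 b (2 + l) (s≤s z≤n) ,
  degree≡1 (L (k + 1) (b + (2 + l)) k (2 + l))
    (vertex⁺ k 1 b (2 + l) {0 , 1} (s≤s z≤n)) (adj⁺ {0 , 0} {0 , 1} ((λ ()) , same , up)) only
  where
  only : ∀ {w} → InL (k + 1) (b + (2 + l)) k (2 + l) w → Adjacent∞ (embed (0 , 0)) w → w ≡ embed (0 , 1)
  only w∈ a with p , refl , p∈ ← vertex⁻ k 1 b (2 + l) w∈ with adj⁻ {0 , 0} {p} a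
  ... | p≢q , same , same = contradiction refl p≢q
  ... | _   , same , up   = refl
  ... | _   , up   , same with s≤s () ← p∈
  ... | _   , up   , up   with s≤s () ← p∈

-- The block is at least two columns wide and ends just above the bottom row, so it swallows all
-- cells above the bottom right corner that could be adjacent to it. Only the left neighbour
-- remains.
leaf-flat : ∀ k a l → HasLeaf (L (2 + k + suc a) (1 + suc l) (2 + k) (suc l))
leaf-flat k a l = embed (suc x , y) , vertex ℕₚ.≤-refl ,
  degree≡1 (L (2 + x) (suc y) (2 + k) y) (vertex (ℕₚ.n≤1+n _))
    (adj⁺ {suc x , y} {x , y} (ℕₚ.1+n≢n ∘ cong proj₁ , down , same)) only
  where
  -- The left neighbour is `(x , y)`, counted from 0, and the corner is `(suc x , y)`.
  x = k + suc a
  y = suc l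

  vertex : ∀ {x′} → x′ < 2 + x → InL (2 + x) (suc y) (2 + k) y (embed (x′ , y))
  vertex x′<m = vertex⁺ (2 + k) (suc a) 1 y
    (rows⁺ y 1 x′<m ℕₚ.≤-refl (λ y<y → contradiction y<y (ℕₚ.n≮n y)))

  only : ∀ {w} → InL (2 + x) (suc y) (2 + k) y w → Adjacent∞ (embed (suc x , y)) w → w ≡ embed (x , y)
  only w∈ e with (x′ , y′) , refl , p∈ ← vertex⁻ (2 + k) (suc a) 1 y w∈
    with x′<m , y′<n , corner ← rows⁻ y 1 {x′} {y′} (ℕₚ.m≤n+m (suc a) (2 + k)) p∈
    with adj⁻ {suc x , y} {x′ , y′} e
  ... | p≢q , same , same = contradiction refl p≢q
  ... | _   , down , same = refl
  ... | _   , up   , _    = contradiction x′<m (ℕₚ.n≮n _)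
  ... | _   , _    , up   = contradiction y′<n (ℕₚ.n≮n _)
  ... | _   , same , down = contradiction (corner ℕₚ.≤-refl) (ℕₚ.≤⇒≯ (ℕₚ.m≤n+m (suc a) (suc k)))
  ... | _   , down , down = contradiction (corner ℕₚ.≤-refl) (ℕₚ.≤⇒≯ (ℕₚ.m≤n+m (suc a) k))

-- Cycle or leaf: the case distinction on the arms

L-cycle : ∀ k a b l → (a ≡ 0 → l ≡ 0) → (b ≡ 0 → k ≡ 0) →
          HasHamiltonianCycle (L (suc k + suc a) (suc b + suc l) (suc k) (suc l))
L-cycle k a b l narrow flat = embed-cycle {P = Rows (lShape (suc l) (suc b) (suc a) (suc k + suc a))}
  (vertex⁺ (suc k) (suc a) (suc b) (suc l)) (vertex⁻ (suc k) (suc a) (suc b) (suc l))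
  (lShape-cycle l b (ℕₚ.m≤n+m (suc a) k) narrow (cong (_+ suc a) ∘ flat))

-- A disjunction keeps the argument constructive: absence of a leaf refutes the right summand.
cycle⊎leaf : ∀ k a b l → let G = L (suc k + suc a) (suc b + suc l) (suc k) (suc l) in
             HasHamiltonianCycle G ⊎ HasLeaf G
cycle⊎leaf k       zero    b       (suc l) = inj₂ (leaf-narrow (suc k) (suc b) l)
cycle⊎leaf (suc k) a       zero    l       = inj₂ (leaf-flat k a l)
cycle⊎leaf zero    zero    zero    zero    = inj₁ (L-cycle 0 0 0 0 (λ _ → refl) (λ _ → refl))
cycle⊎leaf zero    (suc a) zero    l       = inj₁ (L-cycle 0 (suc a) 0 l (λ ()) (λ _ → refl))
cycle⊎leaf k       zero    (suc b) zero    = inj₁ (L-cycle k 0 (suc b) 0 (λ _ → refl) (λ ()))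
cycle⊎leaf k       (suc a) (suc b) l       = inj₁ (L-cycle k (suc a) (suc b) l (λ ()) (λ ()))

positive-∸ : ∀ m k → m ∸ k ≥ 1 → ∃[ a ] m ≡ k + suc a
positive-∸ (suc m) zero    _ = m , refl
positive-∸ (suc m) (suc k) p with a , refl ← positive-∸ m k p = a , refl

theorem2 : (m n k l : ℕ) → m > 1 → n > 1 → k ≥ 1 → l ≥ 1 → m ∸ k ≥ 1 → n ∸ l ≥ 1 →
    HasHamiltonianCycle (L m n k l) ⇔ (¬ (∃[ v ] Vertex (L m n k l) v × degree (L m n k l) v ≡ 1))
theorem2 m n (suc k) (suc l) _ _ _ _ a≥1 b≥1
  with a , refl ← positive-∸ m (suc k) a≥1
     | b , n≡ ← positive-∸ n (suc l) b≥1
  -- The height becomes lower arm plus block, the order used in `vertex⁺`.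
  with refl ← trans n≡ (ℕₚ.+-comm (suc l) (suc b)) =
  mk⇔ (cycle⇒¬leaf G) λ no-leaf → fromInj₁ (λ leaf → contradiction leaf no-leaf) (cycle⊎leaf k a b l)
  where G = L (suc k + suc a) (suc b + suc l) (suc k) (suc l)
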